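{- Let $a,b,c$ be positive integers with $c\ge 2$ and $\gcd(b,c)=1$. Then $G_{a,b}(c)=H(a,b,c)$.
   Context: $\mathbb{N}$ denotes the set of non-negative integers (including $0$). For positive integers $a,b$ let $\theta_{a,b}:\mathbb{N}\to\mathbb{N}$, $x\mapsto ax+b$. A subsemigroup $G$ of $(\mathbb{N},+)$ containing $0$ is called a $\theta_{a,b}$-semigroup if $\theta_{a,b}(y)\in G$ for every $y\in G\setminus\{0\}$. $G_{a,b}(c)$ denotes the smallest (with respect to inclusion) $\theta_{a,b}$-semigroup containing $c$. For $k\in\mathbb{N}$ set $s_0(a)=0$ and $s_k(a)=\sum_{i=0}^{k-1}a^i$ for $k\ge 1$, and $t_k(a,b,c)=a^kc+b\cdot s_k(a)$. Let $S(a,b,c)=\{t_k(a,b,c):k\in\mathbb{N}\}$. For $S\subseteq\mathbb{N}$, $\langle S\rangle$ denotes the set of all finite linear combinations of elements of $S$ with coefficients in $\mathbb{N}$ (so $0\in\langle S\rangle$). $H(a,b,c)=\langle S(a,b,c)\rangle$. -}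

module Defs where

open import Data.List.Base using (map; sum; upTo)
open import Data.List.Relation.Unary.All using (All)
open import Data.Nat.Base using (ℕ; _+_; _*_; _^_)
open import Data.Product.Base using (∃-syntax; _×_; _,_; proj₂; uncurry)
open import Level using (0ℓ)
open import Relation.Binary.PropositionalEquality.Core using (_≡_; _≢_)
open import Relation.Unary using (Pred; _∈_; _⊆_)

θ : ℕ → ℕ → ℕ → ℕ
θ a b x = a * x + b

record IsθSemigroup (a b : ℕ) (G : Pred ℕ 0ℓ) : Set where
  field
    0∈       : 0 ∈ G
    +-closed : ∀ {x y} → x ∈ G → y ∈ G → x + y ∈ G
    θ-closed : ∀ {y} → y ∈ G → y ≢ 0 → θ a b y ∈ G

-- G is the subset G_{a,b}(c).  Any two such G have the same elements, and
-- smallest-exists below shows that there is one.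
record IsSmallestθSemigroup (a b c : ℕ) (G : Pred ℕ 0ℓ) : Set₁ where
  field
    isθSemigroup : IsθSemigroup a b G
    c∈           : c ∈ G
    smallest     : (T : Pred ℕ 0ℓ) → IsθSemigroup a b T → c ∈ T → G ⊆ T

s : ℕ → ℕ → ℕ
s k a = sum (map (a ^_) (upTo k))

t : ℕ → ℕ → ℕ → ℕ → ℕ
t k a b c = a ^ k * c + b * s k a

S : ℕ → ℕ → ℕ → Pred ℕ 0ℓ
S a b c n = ∃[ k ] n ≡ t k a b c

-- A linear combination is a list of (coefficient , element) pairs; the empty
-- list gives 0.
⟨_⟩ : Pred ℕ 0ℓ → Pred ℕ 0ℓ
⟨ P ⟩ n = ∃[ ps ] All (λ p → proj₂ p ∈ P) ps × n ≡ sum (map (uncurry _*_) ps)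

H : ℕ → ℕ → ℕ → Pred ℕ 0ℓ
H a b c = ⟨ S a b c ⟩

-- Used only to show that a smallest θ-semigroup containing c exists.
data Generated (a b c : ℕ) : Pred ℕ 0ℓ where
  gen  : Generated a b c c
  zero : Generated a b c 0
  add  : ∀ {x y} → Generated a b c x → Generated a b c y → Generated a b c (x + y)
  step : ∀ {y} → Generated a b c y → y ≢ 0 → Generated a b c (θ a b y)

smallest-exists : ∀ a b c → ∃[ G ] IsSmallestθSemigroup a b c G
smallest-exists a b c = Generated a b c , record
  { isθSemigroup = record { 0∈ = zero ; +-closed = add ; θ-closed = step }
  ; c∈           = gen
  ; smallest     = λ T isT c∈T → go T isT c∈T
  }
  where
  go : (T : Pred ℕ 0ℓ) → IsθSemigroup a b T → c ∈ T → Generated a b c ⊆ T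
  go T isT c∈T gen         = c∈T
  go T isT c∈T zero        = IsθSemigroup.0∈ isT
  go T isT c∈T (add p q)   = IsθSemigroup.+-closed isT (go T isT c∈T p) (go T isT c∈T q)
  go T isT c∈T (step p nz) = IsθSemigroup.θ-closed isT (go T isT c∈T p) nz

{-# OPTIONS --safe #-}
module Submission where

-- Write H for H a b c, the additive submonoid spanned by the numbers
-- t k = t k a b c.  It suffices that H is a θ-semigroup containing c and that
-- every θ-semigroup containing c contains H.
--
-- Both rest on two facts: θ carries t k to t (k + 1), with t 0 = c
-- (t-zero, θ-t), and ⟨ P ⟩ lies in every additive submonoid that contains P
-- (⟨⟩-least).
--
-- A θ-semigroup containing c contains every t k by induction on k, as t k is
-- nonzero (t≢0), and hence contains H.
--
-- For the θ-closure of H (H-θ-closed), note that θ (x + y) = θ x + a * y.  If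
-- x and y lie in H and θ x does too, then θ (x + y) lies in H, because H is
-- closed under multiplication by a.  So the elements of H that are zero or
-- whose image under θ is in H form a submonoid; it contains every t k, and
-- hence is all of H.

open import Defs
open import Data.List.Base using ([]; _∷_; _++_; map; upTo; applyUpTo)
open import Data.List.Properties using (map-∘; map-applyUpTo; map-++)
open import Data.List.Relation.Unary.All using (All; []; _∷_)
open import Data.List.Relation.Unary.All.Properties using (++⁺)
open import Data.Nat.Base using (ℕ; zero; suc; _+_; _*_; _^_; _≤_; z≤n; s≤s; NonZero; >-nonZero; ≢-nonZero⁻¹)
open import Data.Nat.GCD using (gcd)
open import Data.Nat.ListAction using (sum)
open import Data.Nat.ListAction.Properties using (sum-++)
open import Data.Nat.Properties using (_≟_; +-identityʳ; *-identityˡ; *-zeroʳ; *-distribˡ-+; m+n≡0⇒m≡0; m*n≢0; m^n≢0; ≤-trans)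
open import Data.Nat.Tactic.RingSolver using (solve-∀)
open import Data.Product.Base using (_×_; _,_; proj₂; uncurry)
open import Level using (0ℓ)
open import Relation.Binary.PropositionalEquality.Core using (_≡_; _≢_; refl; sym; trans; cong; cong₂; subst)
open import Relation.Binary.PropositionalEquality.Properties using (module ≡-Reasoning)
open import Relation.Nullary using (yes; no; contradiction)
open import Relation.Unary using (Pred; _≐_; _∈_; _⊆_)

-- T is a submonoid of (ℕ, +, 0).
record IsSubmonoid (T : Pred ℕ 0ℓ) : Set where
  field
    0∈       : 0 ∈ T
    +-closed : ∀ {x y} → x ∈ T → y ∈ T → x + y ∈ T

  *-closed : ∀ n {x} → x ∈ T → n * x ∈ T
  *-closed zero    x∈T = 0∈
  *-closed (suc n) x∈T = +-closed x∈T (*-closed n x∈T)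

module _ {P : Pred ℕ 0ℓ} where

  ⟨⟩-isSubmonoid : IsSubmonoid ⟨ P ⟩
  ⟨⟩-isSubmonoid = record { 0∈ = [] , [] , refl ; +-closed = closed }
    where
    closed : ∀ {x y} → x ∈ ⟨ P ⟩ → y ∈ ⟨ P ⟩ → x + y ∈ ⟨ P ⟩
    closed {x} {y} (ps , ps⊆P , x≡) (qs , qs⊆P , y≡) =
      ps ++ qs , ++⁺ ps⊆P qs⊆P , (begin
        x + y                                  ≡⟨ cong₂ _+_ x≡ y≡ ⟩
        sum (map f ps) + sum (map f qs)        ≡⟨ sum-++ (map f ps) (map f qs) ⟨
        sum (map f ps ++ map f qs)             ≡⟨ cong sum (map-++ f ps qs) ⟨
        sum (map f (ps ++ qs))                 ∎)
      where
      open ≡-Reasoning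
      f = uncurry _*_

  ⊆⟨⟩ : P ⊆ ⟨ P ⟩
  ⊆⟨⟩ {x} x∈P =
    (1 , x) ∷ [] , x∈P ∷ [] , sym (trans (+-identityʳ (1 * x)) (*-identityˡ x))

  ⟨⟩-least : ∀ {T} → IsSubmonoid T → P ⊆ T → ⟨ P ⟩ ⊆ T
  ⟨⟩-least {T} isT P⊆T (ps , ps⊆P , refl) = go ps ps⊆P
    where
    open IsSubmonoid isT
    go : ∀ qs → All (λ q → proj₂ q ∈ P) qs → sum (map (uncurry _*_) qs) ∈ T
    go []             []            = 0∈
    go ((n , x) ∷ qs) (x∈P ∷ qs⊆P) = +-closed (*-closed n (P⊆T x∈P)) (go qs qs⊆P)

sum-map-* : ∀ a xs → sum (map (a *_) xs) ≡ a * sum xs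
sum-map-* a []       = sym (*-zeroʳ a)
sum-map-* a (x ∷ xs) =
  trans (cong (a * x +_) (sum-map-* a xs)) (sym (*-distribˡ-+ a x (sum xs)))

s-suc : ∀ k a → s (suc k) a ≡ 1 + a * s k a
s-suc k a = cong (1 +_) (begin
  sum (map (a ^_) (applyUpTo suc k))        ≡⟨ cong (λ is → sum (map (a ^_) is)) (map-applyUpTo (λ i → i) suc k) ⟨
  sum (map (a ^_) (map suc (upTo k)))       ≡⟨ cong sum (map-∘ (upTo k)) ⟨
  sum (map (λ i → a * a ^ i) (upTo k))      ≡⟨ cong sum (map-∘ (upTo k)) ⟩
  sum (map (a *_) (map (a ^_) (upTo k)))    ≡⟨ sum-map-* a (map (a ^_) (upTo k)) ⟩
  a * s k a                                 ∎)
  where open ≡-Reasoning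

t-zero : ∀ a b c → t 0 a b c ≡ c
t-zero = unfolded
  where
  unfolded : ∀ a b c → 1 * c + b * 0 ≡ c
  unfolded = solve-∀

θ-t : ∀ k a b c → θ a b (t k a b c) ≡ t (suc k) a b c
θ-t k a b c =
  trans (distribute a b c (a ^ k) (s k a))
        (cong (λ σ → a ^ suc k * c + b * σ) (sym (s-suc k a)))
  where
  distribute : ∀ a b c p σ → a * (p * c + b * σ) + b ≡ a * p * c + b * (1 + a * σ)
  distribute = solve-∀

t≢0 : ∀ k a b c .{{_ : NonZero a}} .{{_ : NonZero c}} → t k a b c ≢ 0
t≢0 k a b c t≡0 =
  ≢-nonZero⁻¹ (a ^ k * c) {{m*n≢0 (a ^ k) c {{m^n≢0 a k}}}}
    (m+n≡0⇒m≡0 (a ^ k * c) t≡0)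

θ-+ : ∀ a b x y → θ a b x + a * y ≡ θ a b (x + y)
θ-+ = unfolded
  where
  unfolded : ∀ a b x y → (a * x + b) + a * y ≡ a * (x + y) + b
  unfolded = solve-∀

module _ (a b c : ℕ) where

  open IsSubmonoid (⟨⟩-isSubmonoid {S a b c})

  -- The elements of H that are zero or are mapped into H by θ.
  Stable : Pred ℕ 0ℓ
  Stable n = n ∈ H a b c × (n ≢ 0 → θ a b n ∈ H a b c)

  Stable-isSubmonoid : IsSubmonoid Stable
  Stable-isSubmonoid = record
    { 0∈       = 0∈ , λ 0≢0 → contradiction refl 0≢0
    ; +-closed = closed
    }
    where
    closed : ∀ {x y} → x ∈ Stable → y ∈ Stable → x + y ∈ Stable
    closed {x} {y} (x∈H , θx∈H) (y∈H , θy∈H) with x ≟ 0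
    ... | yes refl = y∈H , θy∈H
    ... | no  x≢0  = +-closed x∈H y∈H , λ _ →
      subst (H a b c) (θ-+ a b x y) (+-closed (θx∈H x≢0) (*-closed a y∈H))

  S⊆Stable : S a b c ⊆ Stable
  S⊆Stable (k , refl) = ⊆⟨⟩ (k , refl) , λ _ → ⊆⟨⟩ (suc k , θ-t k a b c)

  -- Since S ⊆ Stable and Stable is a submonoid, all of H is Stable.
  H-θ-closed : ∀ {y} → y ∈ H a b c → y ≢ 0 → θ a b y ∈ H a b c
  H-θ-closed y∈H = proj₂ (⟨⟩-least {T = Stable} Stable-isSubmonoid S⊆Stable y∈H)

  H-isθSemigroup : IsθSemigroup a b (H a b c)
  H-isθSemigroup = record { 0∈ = 0∈ ; +-closed = +-closed ; θ-closed = H-θ-closed }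

  c∈H : c ∈ H a b c
  c∈H = ⊆⟨⟩ (0 , sym (t-zero a b c))

  H⊆θSemigroup : .{{_ : NonZero a}} .{{_ : NonZero c}} →
    ∀ {T} → IsθSemigroup a b T → c ∈ T → H a b c ⊆ T
  H⊆θSemigroup {T} isT c∈T =
    ⟨⟩-least {T = T} (record { 0∈ = T.0∈ ; +-closed = T.+-closed }) λ { (k , refl) → t∈T k }
    where
    module T = IsθSemigroup isT
    -- The closure of T under θ applies only to nonzero elements, hence t≢0.
    t∈T : ∀ k → t k a b c ∈ T
    t∈T zero    = subst T (sym (t-zero a b c)) c∈T
    t∈T (suc k) = subst T (θ-t k a b c) (T.θ-closed (t∈T k) (t≢0 k a b c))

theorem3p1 : (a b c : ℕ) → 1 ≤ a → 1 ≤ b → 2 ≤ c → gcd b c ≡ 1 →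
    (G : Pred ℕ 0ℓ) → IsSmallestθSemigroup a b c G → G ≐ H a b c
theorem3p1 a b c 1≤a _ 2≤c _ G isG =
    smallest (H a b c) (H-isθSemigroup a b c) (c∈H a b c)
  , H⊆θSemigroup a b c {{>-nonZero 1≤a}} {{>-nonZero (≤-trans (s≤s z≤n) 2≤c)}} isθSemigroup c∈
  where open IsSmallestθSemigroup isG
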